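{- Let $p$ be a program, let $\varphi$ be a first-order formula in $\mathcal{L}=\{0,1,+,-,\cdot,\leq\}$ whose free variables are program variables, let $\exists \overline{X}\, \pi$ be the Horn formula equation $\exists X_0\, \mathrm{vc}(\{\varphi\}p\{X_0\})$, and let $\mu = [\mathrm{lfp}_{X_0}\, \Phi_{\pi}]$. Then $[\mu] = \mathrm{sp}(p,\varphi)$.
   Context: Language and programs: $\mathcal{L}=\{0,1,+,-,\cdot,\leq\}$ is the first-order language of arithmetic (with equality) and $\mathbb{Z}$ its standard model on the integers. Let $x_1,\ldots,x_k$ be the program variables. Programs are given by $$p ::= \textbf{skip} \mid x_j := t \mid p_0;p_1 \mid \textbf{if } B \textbf{ then } p_0 \textbf{ else } p_1 \mid \textbf{while } B \textbf{ do } p_0,$$ with $t$ an $\mathcal{L}$-term and $B$ a quantifier-free $\mathcal{L}$-formula, both over the program variables. A state is a map from $\{x_1,\ldots,x_k\}$ to $\mathbb{Z}$; $\Sigma$ is the set of states. $C(p)$ is the usual denotational semantics of $p$, a partial function $\Sigma\to\Sigma$ (undefined on non-terminating runs). Strongest postcondition: $\mathrm{sp}(p,\varphi)=\{\sigma\in\Sigma\mid \exists\sigma'\in\Sigma:\ \mathbb{Z},\sigma'\models\varphi \text{ and } C(p)(\sigma')=\sigma\}$. For a formula $\theta$ all of whose free variables are program variables, $[\theta]=\{\sigma\in\Sigma\mid\mathbb{Z},\sigma\models\theta\}$; for a $k$-ary predicate $\mu$, $[\mu]=[\mu(x_1,\ldots,x_k)]$. Verification condition: $\mathrm{vc}(\{\varphi\}p\{\psi\})=\exists\overline{I}\,\forall^*\,\widetilde{\mathrm{vc}}(\{\varphi\}p\{\psi\})$,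 where $\forall^*$ is universal closure over individual variables, $\overline{I}$ are the fresh predicate variables introduced in (3) and (5) below, and $\widetilde{\mathrm{vc}}$ is defined (also for $\varphi,\psi$ containing predicate variables) by recursion on $p$: (1) $\widetilde{\mathrm{vc}}(\{\varphi\}\textbf{skip}\{\psi\})=\varphi\to\psi$; (2) $\widetilde{\mathrm{vc}}(\{\varphi\}x_j:=t\{\psi\})=\varphi\to\psi[x_j\backslash t]$; (3) $\widetilde{\mathrm{vc}}(\{\varphi\}p_0;p_1\{\psi\})=\widetilde{\mathrm{vc}}(\{\varphi\}p_0\{I\})\land\widetilde{\mathrm{vc}}(\{I\}p_1\{\psi\})$; (4) $\widetilde{\mathrm{vc}}(\{\varphi\}\textbf{if }B\textbf{ then }p_0\textbf{ else }p_1\{\psi\})=\widetilde{\mathrm{vc}}(\{\varphi\land B\}p_0\{\psi\})\land\widetilde{\mathrm{vc}}(\{\varphi\land\neg B\}p_1\{\psi\})$; (5) $\widetilde{\mathrm{vc}}(\{\varphi\}\textbf{while }B\textbf{ do }p_0\{\psi\})=\widetilde{\mathrm{vc}}(\{I\land B\}p_0\{I\})\land(\varphi\to I)\land(I\land\neg B\to\psi)$. In (3) and (5), $I$ is a fresh $k$-ary predicate variable (distinct from all others used), abbreviating the atom $I(x_1,\ldots,x_k)$, so $I[x_j\backslash t]$ is $I(x_1,\ldots,t,\ldots,x_k)$. Likewise $X_0$ is a $k$-ary predicate variable abbreviating $X_0(x_1,\ldots,x_k)$. Thus $\exists X_0\,\mathrm{vc}(\{\varphi\}p\{X_0\})$ is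 $\exists\overline{X}\,\pi$ with $\overline{X}=(X_0,\overline{I})=(X_0,X_1,\ldots,X_n)$ and $\pi=\forall^*\,\widetilde{\mathrm{vc}}(\{\varphi\}p\{X_0\})$. Horn form: every conjunct of $\pi$ is an implication whose premise is a conjunction of first-order formulas and at most one predicate-variable atom and whose conclusion is a predicate-variable atom or a first-order formula; a conjunct $A\to\theta$ with $\theta$ first-order is read as $A\land\neg\theta\to\bot$. So $\pi$ is a conjunction of constrained Horn clauses, i.e. formulas $\varphi' \land X_{i_1}(\overline{t_1}) \land \cdots \land X_{i_m}(\overline{t_m}) \to X_{i_0}(\overline{s})$ or with $\bot$ as conclusion ($m\ge0$, $\varphi'$ first-order without predicate variables). Least fixed points: for a tuple $\Phi=(\varphi_i(X_0,\ldots,X_n,\overline{u_i}))_{i=0}^n$ of formulas in which the $X_j$ occur only positively, with $|\overline{u_i}|=k_i$ the arity of $X_i$, and a structure $\mathcal{M}$ with domain $M$, let $F_\Phi=(F_0,\ldots,F_n)$ on $\mathcal{P}(M^{k_0})\times\cdots\times\mathcal{P}(M^{k_n})$, $F_i(R_0,\ldots,R_n)=\{\overline{a}\in M^{k_i}\mid \mathcal{M}\models\varphi_i(R_0,\ldots,R_n,\overline{a})\}$. This is monotone; $[\mathrm{lfp}_{X_i}\,\Phi]$ is interpreted in $\mathcal{M}$ as the $X_i$-component of the least fixed point of $F_\Phi$. The tuple $\Phi_\pi$: let $B_j$ be the set of clauses of $\pi$ of the form $\varphi'\to X_j(\overline{s})$, written $(\varphi',\overline{s})$, and $\mathrm{Ind}_j$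 the set of clauses $\varphi'\land X_{i_1}(\overline{t_1})\land\cdots\land X_{i_m}(\overline{t_m})\to X_j(\overline{s})$ with $m\ge1$, written $(\varphi',\iota,\tau,\overline{s})$, $\iota=(i_1,\ldots,i_m)$, $\tau=(\overline{t_1},\ldots,\overline{t_m})$. Then $\Phi_\pi=(\varphi_j(X_0,\ldots,X_n,\overline{z_j}))_{j=0}^n$, where $\varphi_j$ is $$\exists \overline{y}\left(\bigvee_{(\varphi',\overline{s})\in B_j}(\varphi'\land\overline{z_j}=\overline{s})\lor\bigvee_{(\varphi',\iota,\tau,\overline{s})\in \mathrm{Ind}_j}\Big(\varphi'\land\bigwedge_{l=1}^m X_{i_l}(\overline{t_l})\land\overline{z_j}=\overline{s}\Big)\right),$$ $\overline{y}$ being the free variables of the clauses in $B_j\cup \mathrm{Ind}_j$ and $\overline{z_j}$ fresh variables, as many as the arity of $X_j$ (empty disjunctions are false). -}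

module Defs where

open import Data.Empty using (⊥; ⊥-elim)
open import Data.Fin using (Fin; zero; suc; _↑ˡ_; _↑ʳ_) renaming (_≟_ to _≟ᶠ_)
open import Data.Integer as ℤ using (ℤ; 0ℤ; 1ℤ)
open import Data.List using (List; []; _∷_; _++_; foldr; map; mapMaybe)
open import Data.Maybe as Maybe using (Maybe; just; nothing)
open import Data.Nat using (ℕ; zero; suc; _+_)
open import Data.Product using (Σ-syntax; ∃-syntax; _×_; _,_; proj₁; proj₂)
open import Data.Sum using (_⊎_; inj₁; inj₂)
open import Data.Unit using (⊤; tt)
open import Data.Vec as Vec using (Vec; []; _∷_; lookup; tabulate; _[_]≔_)
open import Function using (_∘_)
open import Level using (0ℓ)
open import Relation.Binary using (Rel)
open import Relation.Binary.PropositionalEquality using (_≡_; refl)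
open import Relation.Nullary using (yes; no)
import Relation.Nullary as N
open import Relation.Unary using (Pred; _⊆_; _≐_)

infix  8 _≈_ _≤_
infix  7 ¬_
infixr 6 _∧_
infixr 5 _∨_
infixr 4 _⇒_

------------------------------------------------------------------------
-- First-order arithmetic

data Term (n : ℕ) : Set where
  var           : Fin n → Term n
  𝟎 𝟏           : Term n
  _⊕_ _⊖_ _⊗_   : Term n → Term n → Term n

-- Variables are de Bruijn indices: a quantifier binds index zero.
data FO (n : ℕ) : Set where
  _≈_ _≤_       : Term n → Term n → FO n
  true false    : FO n
  _∧_ _∨_ _⇒_   : FO n → FO n → FO n
  ∃′ ∀′         : FO (suc n) → FO n

¬_ : ∀ {n} → FO n → FO n
¬ θ = θ ⇒ false

QuantifierFree : ∀ {n} → FO n → Set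
QuantifierFree (s ≈ t) = ⊤
QuantifierFree (s ≤ t) = ⊤
QuantifierFree true    = ⊤
QuantifierFree false   = ⊤
QuantifierFree (A ∧ B) = QuantifierFree A × QuantifierFree B
QuantifierFree (A ∨ B) = QuantifierFree A × QuantifierFree B
QuantifierFree (A ⇒ B) = QuantifierFree A × QuantifierFree B
QuantifierFree (∃′ A)  = ⊥
QuantifierFree (∀′ A)  = ⊥

Env : ℕ → Set
Env n = Vec ℤ n

eval : ∀ {n} → Env n → Term n → ℤ
eval ρ (var i) = lookup ρ i
eval ρ 𝟎       = 0ℤ
eval ρ 𝟏       = 1ℤ
eval ρ (s ⊕ t) = eval ρ s ℤ.+ eval ρ t
eval ρ (s ⊖ t) = eval ρ s ℤ.- eval ρ t
eval ρ (s ⊗ t) = eval ρ s ℤ.* eval ρ t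

⟦_⟧ : ∀ {n} → FO n → Pred (Env n) 0ℓ
⟦ s ≈ t ⟧ ρ = eval ρ s ≡ eval ρ t
⟦ s ≤ t ⟧ ρ = eval ρ s ℤ.≤ eval ρ t
⟦ true  ⟧ ρ = ⊤
⟦ false ⟧ ρ = ⊥
⟦ A ∧ B ⟧ ρ = ⟦ A ⟧ ρ × ⟦ B ⟧ ρ
⟦ A ∨ B ⟧ ρ = ⟦ A ⟧ ρ ⊎ ⟦ B ⟧ ρ
⟦ A ⇒ B ⟧ ρ = ⟦ A ⟧ ρ → ⟦ B ⟧ ρ
⟦ ∃′ A  ⟧ ρ = ∃[ z ] ⟦ A ⟧ (z ∷ ρ)
⟦ ∀′ A  ⟧ ρ = ∀ z → ⟦ A ⟧ (z ∷ ρ)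

-- A simultaneous substitution lists the terms replacing the variables.
Subst : ℕ → ℕ → Set
Subst n m = Vec (Term m) n

x̄ : ∀ {n} → Subst n n
x̄ = tabulate var

subᵗ : ∀ {n m} → Subst n m → Term n → Term m
subᵗ σ (var i) = lookup σ i
subᵗ σ 𝟎       = 𝟎
subᵗ σ 𝟏       = 𝟏
subᵗ σ (s ⊕ t) = subᵗ σ s ⊕ subᵗ σ t
subᵗ σ (s ⊖ t) = subᵗ σ s ⊖ subᵗ σ t
subᵗ σ (s ⊗ t) = subᵗ σ s ⊗ subᵗ σ t

lift : ∀ {n m} → Subst n m → Subst (suc n) (suc m)
lift σ = var zero ∷ Vec.map (subᵗ (tabulate (var ∘ suc))) σ

subᶠ : ∀ {n m} → Subst n m → FO n → FO m
subᶠ σ (s ≈ t) = subᵗ σ s ≈ subᵗ σ t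
subᶠ σ (s ≤ t) = subᵗ σ s ≤ subᵗ σ t
subᶠ σ true    = true
subᶠ σ false   = false
subᶠ σ (A ∧ B) = subᶠ σ A ∧ subᶠ σ B
subᶠ σ (A ∨ B) = subᶠ σ A ∨ subᶠ σ B
subᶠ σ (A ⇒ B) = subᶠ σ A ⇒ subᶠ σ B
subᶠ σ (∃′ A)  = ∃′ (subᶠ (lift σ) A)
subᶠ σ (∀′ A)  = ∀′ (subᶠ (lift σ) A)

------------------------------------------------------------------------
-- Programs

record Test (k : ℕ) : Set where
  constructor _,_
  field
    formula        : FO k
    quantifierFree : QuantifierFree formula

open Test public using (formula)

infixr 3 _⨾_
infix  4 _≔_ if_then_else_ while_do′_

data Program (k : ℕ) : Set where
  skip          : Program k
  _≔_           : Fin k → Term k → Program k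
  _⨾_           : Program k → Program k → Program k
  if_then_else_ : Test k → Program k → Program k → Program k
  while_do′_     : Test k → Program k → Program k

State : ℕ → Set
State k = Vec ℤ k

data While {k} (B : Pred (State k) 0ℓ) (R : Rel (State k) 0ℓ) : Rel (State k) 0ℓ where
  exit : ∀ {σ} → N.¬ B σ → While B R σ σ
  loop : ∀ {σ σ′ σ″} → B σ → R σ σ′ → While B R σ′ σ″ → While B R σ σ″

-- The graph of the partial function denoted by a program: C p σ σ′ says that
-- p started in σ terminates in σ′.
C : ∀ {k} → Program k → Rel (State k) 0ℓ
C skip                   σ σ′ = σ ≡ σ′
C (j ≔ t)                σ σ′ = σ [ j ]≔ eval σ t ≡ σ′
C (p ⨾ q)                σ σ′ = ∃[ τ ] C p σ τ × C q τ σ′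
C (if B then p else q)   σ σ′ = (⟦ formula B ⟧ σ × C p σ σ′) ⊎ (⟦ ¬ formula B ⟧ σ × C q σ σ′)
C (while B do′ p)              = While ⟦ formula B ⟧ (C p)

While-functional : ∀ {k} {B : Pred (State k) 0ℓ} {R : Rel (State k) 0ℓ} →
  (∀ {σ τ τ′} → R σ τ → R σ τ′ → τ ≡ τ′) →
  ∀ {σ τ τ′} → While B R σ τ → While B R σ τ′ → τ ≡ τ′
While-functional f (exit _)     (exit _)      = refl
While-functional f (exit ¬b)    (loop b _ _)  = ⊥-elim (¬b b)
While-functional f (loop b _ _) (exit ¬b)     = ⊥-elim (¬b b)
While-functional f (loop _ r w) (loop _ r′ w′) with refl ← f r r′ = While-functional f w w′

C-functional : ∀ {k} (p : Program k) {σ τ τ′} → C p σ τ → C p σ τ′ → τ ≡ τ′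
C-functional skip refl refl = refl
C-functional (j ≔ t) refl refl = refl
C-functional (p ⨾ q) (_ , c , d) (_ , c′ , d′) with refl ← C-functional p c c′ = C-functional q d d′
C-functional (if B then p else q) (inj₁ (_ , c)) (inj₁ (_ , c′)) = C-functional p c c′
C-functional (if B then p else q) (inj₁ (b , _)) (inj₂ (¬b , _)) = ⊥-elim (¬b b)
C-functional (if B then p else q) (inj₂ (¬b , _)) (inj₁ (b , _)) = ⊥-elim (¬b b)
C-functional (if B then p else q) (inj₂ (_ , c)) (inj₂ (_ , c′)) = C-functional q c c′
C-functional (while B do′ p) = While-functional (C-functional p)

sp : ∀ {k} → Program k → FO k → Pred (State k) 0ℓ
sp p φ σ = ∃[ σ′ ] ⟦ φ ⟧ σ′ × C p σ′ σ

------------------------------------------------------------------------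
-- Formulas with predicate variables

-- The predicate variables are X₀, …, Xₘ₋₁, where Xᵢ has arity ar i.
data Formula {m : ℕ} (ar : Fin m → ℕ) (n : ℕ) : Set where
  ⌊_⌋         : FO n → Formula ar n
  atom        : (X : Fin m) → Vec (Term n) (ar X) → Formula ar n
  _∧_ _∨_ _⇒_ : Formula ar n → Formula ar n → Formula ar n
  ∃′ ∀′       : Formula ar (suc n) → Formula ar n

module _ {m : ℕ} {ar : Fin m → ℕ} where

  sub : ∀ {n n′} → Subst n n′ → Formula ar n → Formula ar n′
  sub σ ⌊ θ ⌋       = ⌊ subᶠ σ θ ⌋
  sub σ (atom X ts) = atom X (Vec.map (subᵗ σ) ts)
  sub σ (A ∧ B)     = sub σ A ∧ sub σ B
  sub σ (A ∨ B)     = sub σ A ∨ sub σ B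
  sub σ (A ⇒ B)     = sub σ A ⇒ sub σ B
  sub σ (∃′ A)      = ∃′ (sub (lift σ) A)
  sub σ (∀′ A)      = ∀′ (sub (lift σ) A)

  _[_\\_] : ∀ {n} → Formula ar n → Fin n → Term n → Formula ar n
  A [ j \\ t ] = sub (x̄ [ j ]≔ t) A

  ⋀ ⋁ : ∀ {n} → List (Formula ar n) → Formula ar n
  ⋀ = foldr _∧_ ⌊ true ⌋
  ⋁ = foldr _∨_ ⌊ false ⌋

  ∃* : ∀ k {n} → Formula ar (k + n) → Formula ar n
  ∃* zero    A = A
  ∃* (suc k) A = ∃* k (∃′ A)

  ∀* : ∀ {n} → Formula ar n → Formula ar 0
  ∀* {zero}  A = A
  ∀* {suc n} A = ∀* (∀′ A)

Interpretation : ∀ {m} → (Fin m → ℕ) → Set₁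
Interpretation ar = ∀ i → Pred (Vec ℤ (ar i)) 0ℓ

⟦_⟧₂ : ∀ {m} {ar : Fin m → ℕ} {n} → Formula ar n → Interpretation ar → Pred (Env n) 0ℓ
⟦ ⌊ θ ⌋     ⟧₂ R ρ = ⟦ θ ⟧ ρ
⟦ atom X ts ⟧₂ R ρ = R X (Vec.map (eval ρ) ts)
⟦ A ∧ B     ⟧₂ R ρ = ⟦ A ⟧₂ R ρ × ⟦ B ⟧₂ R ρ
⟦ A ∨ B     ⟧₂ R ρ = ⟦ A ⟧₂ R ρ ⊎ ⟦ B ⟧₂ R ρ
⟦ A ⇒ B     ⟧₂ R ρ = ⟦ A ⟧₂ R ρ → ⟦ B ⟧₂ R ρ
⟦ ∃′ A      ⟧₂ R ρ = ∃[ z ] ⟦ A ⟧₂ R (z ∷ ρ)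
⟦ ∀′ A      ⟧₂ R ρ = ∀ z → ⟦ A ⟧₂ R (z ∷ ρ)

-- [ μ ] is [ μ (x₁, …, xₖ) ].
[_] : ∀ {k} → Pred (Vec ℤ k) 0ℓ → Pred (State k) 0ℓ
[ μ ] σ = μ (Vec.map (eval σ) x̄)

------------------------------------------------------------------------
-- Verification conditions

-- The number of predicate variables introduced for a program.
fresh : ∀ {k} → Program k → ℕ
fresh skip                 = 0
fresh (j ≔ t)              = 0
fresh (p ⨾ q)              = suc (fresh p + fresh q)
fresh (if B then p else q) = fresh p + fresh q
fresh (while B do′ p)       = suc (fresh p)

-- The injection ν assigns to the variables introduced for p their names among
-- the m predicate variables; φ and ψ must not use names in its image.
vc̃ : ∀ {k m} (p : Program k) (ν : Fin (fresh p) → Fin m) →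
     (φ ψ : Formula {m} (λ _ → k) k) → Formula {m} (λ _ → k) k
vc̃ skip ν φ ψ = φ ⇒ ψ
vc̃ (j ≔ t) ν φ ψ = φ ⇒ ψ [ j \\ t ]
vc̃ (p ⨾ q) ν φ ψ =
  let I = atom (ν zero) x̄ in
  vc̃ p (λ i → ν (suc (i ↑ˡ fresh q))) φ I ∧
  vc̃ q (λ i → ν (suc (fresh p ↑ʳ i))) I ψ
vc̃ (if B then p else q) ν φ ψ =
  vc̃ p (λ i → ν (i ↑ˡ fresh q)) (φ ∧ ⌊ formula B ⌋) ψ ∧
  vc̃ q (λ i → ν (fresh p ↑ʳ i)) (φ ∧ ⌊ ¬ formula B ⌋) ψ
vc̃ (while B do′ p) ν φ ψ =
  let I = atom (ν zero) x̄ in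
  vc̃ p (ν ∘ suc) (I ∧ ⌊ formula B ⌋) I ∧
  (φ ⇒ I) ∧
  (I ∧ ⌊ ¬ formula B ⌋ ⇒ ψ)

------------------------------------------------------------------------
-- Horn formula equations

Atom : ∀ {m} → (Fin m → ℕ) → ℕ → Set
Atom ar n = Σ[ X ∈ _ ] Vec (Term n) (ar X)

-- constraint ∧ body → head, where the head nothing stands for falsity.
record Clause {m} (ar : Fin m → ℕ) (n : ℕ) : Set where
  constructor clause
  field
    constraint : FO n
    body       : List (Atom ar n)
    head       : Maybe (Atom ar n)

module _ {m : ℕ} {ar : Fin m → ℕ} {n : ℕ} where

  data Premise : Formula ar n → Set where
    ⌊_⌋  : ∀ θ → Premise ⌊ θ ⌋
    atom : ∀ X ts → Premise (atom X ts)
    _∧_  : ∀ {A B} → Premise A → Premise B → Premise (A ∧ B)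

  data Conclusion : Formula ar n → Set where
    ⌊_⌋  : ∀ θ → Conclusion ⌊ θ ⌋
    atom : ∀ X ts → Conclusion (atom X ts)

  data Horn : Formula ar n → Set where
    _⇒_ : ∀ {A B} → Premise A → Conclusion B → Horn (A ⇒ B)
    _∧_ : ∀ {A B} → Horn A → Horn B → Horn (A ∧ B)

  constraint : ∀ {A} → Premise A → FO n
  constraint ⌊ θ ⌋       = θ
  constraint (atom X ts) = true
  constraint (A ∧ B)     = constraint A ∧ constraint B

  atoms : ∀ {A} → Premise A → List (Atom ar n)
  atoms ⌊ θ ⌋       = []
  atoms (atom X ts) = (X , ts) ∷ []
  atoms (A ∧ B)     = atoms A ++ atoms B

  -- A ⇒ θ with θ first-order is read as A ∧ ¬ θ ⇒ ⊥.
  clauses : ∀ {A} → Horn A → List (Clause ar n)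
  clauses (A ⇒ ⌊ θ ⌋)     = clause (constraint A ∧ ¬ θ) (atoms A) nothing ∷ []
  clauses (A ⇒ atom X ts) = clause (constraint A) (atoms A) (just (X , ts)) ∷ []
  clauses (A ∧ B)         = clauses A ++ clauses B

-- The equation ∃ X₀ … Xₘ₋₁ ∀* matrix.
record HornFormulaEquation : Set where
  field
    {m}    : ℕ
    ar     : Fin m → ℕ
    {n}    : ℕ
    matrix : Formula ar n
    horn   : Horn matrix

  π : Formula ar 0
  π = ∀* matrix

Conclusion⇒Premise : ∀ {m} {ar : Fin m → ℕ} {n} {A : Formula ar n} → Conclusion A → Premise A
Conclusion⇒Premise ⌊ θ ⌋       = ⌊ θ ⌋
Conclusion⇒Premise (atom X ts) = atom X ts

Conclusion-sub : ∀ {m} {ar : Fin m → ℕ} {n n′} (σ : Subst n n′) {A : Formula ar n} →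
                 Conclusion A → Conclusion (sub σ A)
Conclusion-sub σ ⌊ θ ⌋       = ⌊ subᶠ σ θ ⌋
Conclusion-sub σ (atom X ts) = atom X (Vec.map (subᵗ σ) ts)

vc̃-horn : ∀ {k m} (p : Program k) (ν : Fin (fresh p) → Fin m) {φ ψ : Formula (λ _ → k) k} →
          Premise φ → Conclusion ψ → Horn (vc̃ p ν φ ψ)
vc̃-horn skip ν A B = A ⇒ B
vc̃-horn (j ≔ t) ν A B = A ⇒ Conclusion-sub _ B
vc̃-horn (p ⨾ q) ν A B = vc̃-horn p _ A (atom _ _) ∧ vc̃-horn q _ (atom _ _) B
vc̃-horn (if T then p else q) ν A B = vc̃-horn p _ (A ∧ ⌊ _ ⌋) B ∧ vc̃-horn q _ (A ∧ ⌊ _ ⌋) B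
vc̃-horn (while T do′ p) ν A B =
  vc̃-horn p _ (atom _ _ ∧ ⌊ _ ⌋) (atom _ _) ∧ (A ⇒ atom _ _) ∧ (atom _ _ ∧ ⌊ _ ⌋ ⇒ B)

-- ∃ X₀ vc({φ} p {X₀}): the predicate variables introduced for p are X₁, …, Xₙ.
∃X₀vc : ∀ {k} → Program k → FO k → HornFormulaEquation
∃X₀vc {k} p φ = record
  { ar     = λ (_ : Fin (suc (fresh p))) → k
  ; matrix = vc̃ p suc ⌊ φ ⌋ (atom zero x̄)
  ; horn   = vc̃-horn p suc ⌊ φ ⌋ (atom zero x̄)
  }

------------------------------------------------------------------------
-- Least fixed points

-- Predicate variables are excluded from premises of implications altogether (no
-- X nested to the left of an even number of them), so that least fixed points
-- exist as inductive types.
data Positive {m} {ar : Fin m → ℕ} {n} : Formula ar n → Set where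
  ⌊_⌋  : ∀ θ → Positive ⌊ θ ⌋
  atom : ∀ X ts → Positive (atom X ts)
  _∧_  : ∀ {A B} → Positive A → Positive B → Positive (A ∧ B)
  _∨_  : ∀ {A B} → Positive A → Positive B → Positive (A ∨ B)
  _⇒_  : ∀ {B} θ → Positive B → Positive (⌊ θ ⌋ ⇒ B)
  ∃′   : ∀ {A} → Positive A → Positive (∃′ A)
  ∀′   : ∀ {A} → Positive A → Positive (∀′ A)

Tuple : ∀ {m} → (Fin m → ℕ) → Set
Tuple ar = ∀ i → Formula ar (ar i)

F : ∀ {m} {ar : Fin m → ℕ} → Tuple ar → Interpretation ar → Interpretation ar
F Φ R i ā = ⟦ Φ i ⟧₂ R ā

record LeastFixedPoint {m} {ar : Fin m → ℕ} (G : Interpretation ar → Interpretation ar) : Set₁ where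
  field
    μ     : Interpretation ar
    fixed : ∀ i → G μ i ≐ μ i
    least : ∀ R → (∀ i → G R i ≐ R i) → ∀ i → μ i ⊆ R i

-- ⟦_⟧₂ restricted to positive formulas, where R is seen to occur strictly positively.
⟦_⟧⁺ : ∀ {m} {ar : Fin m → ℕ} {n} {A : Formula ar n} →
       Positive A → Interpretation ar → Pred (Env n) 0ℓ
⟦ ⌊ θ ⌋     ⟧⁺ R ρ = ⟦ θ ⟧ ρ
⟦ atom X ts ⟧⁺ R ρ = R X (Vec.map (eval ρ) ts)
⟦ A ∧ B     ⟧⁺ R ρ = ⟦ A ⟧⁺ R ρ × ⟦ B ⟧⁺ R ρ
⟦ A ∨ B     ⟧⁺ R ρ = ⟦ A ⟧⁺ R ρ ⊎ ⟦ B ⟧⁺ R ρ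
⟦ θ ⇒ B     ⟧⁺ R ρ = ⟦ θ ⟧ ρ → ⟦ B ⟧⁺ R ρ
⟦ ∃′ A      ⟧⁺ R ρ = Σ[ z ∈ ℤ ] ⟦ A ⟧⁺ R (z ∷ ρ)
⟦ ∀′ A      ⟧⁺ R ρ = ∀ z → ⟦ A ⟧⁺ R (z ∷ ρ)

to⁺ : ∀ {m} {ar : Fin m → ℕ} {n} {A : Formula ar n} (P : Positive A) {R : Interpretation ar} →
      ⟦ A ⟧₂ R ⊆ ⟦ P ⟧⁺ R
to⁺ ⌊ θ ⌋       a        = a
to⁺ (atom X ts) a        = a
to⁺ (P ∧ Q)     (a , b)  = to⁺ P a , to⁺ Q b
to⁺ (P ∨ Q)     (inj₁ a) = inj₁ (to⁺ P a)
to⁺ (P ∨ Q)     (inj₂ b) = inj₂ (to⁺ Q b)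
to⁺ (θ ⇒ Q)     f        = λ a → to⁺ Q (f a)
to⁺ (∃′ P)      (z , a)  = z , to⁺ P a
to⁺ (∀′ P)      f        = λ z → to⁺ P (f z)

module _ {m : ℕ} {ar : Fin m → ℕ} (Φ : Tuple ar) (Φ⁺ : ∀ i → Positive (Φ i)) where

  data Lfp : Interpretation ar where
    fold : ∀ {i ā} → ⟦ Φ⁺ i ⟧⁺ Lfp ā → Lfp i ā

  module _ {R : Interpretation ar} (pre : ∀ i → F Φ R i ⊆ R i) where

    Lfp-least : ∀ {i} → Lfp i ⊆ R i
    Lfp-map   : ∀ {n} {A : Formula ar n} (P : Positive A) → ⟦ P ⟧⁺ Lfp ⊆ ⟦ A ⟧₂ R

    Lfp-least (fold x) = pre _ (Lfp-map (Φ⁺ _) x)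

    Lfp-map ⌊ θ ⌋       a        = a
    Lfp-map (atom X ts) a        = Lfp-least a
    Lfp-map (P ∧ Q)     (a , b)  = Lfp-map P a , Lfp-map Q b
    Lfp-map (P ∨ Q)     (inj₁ a) = inj₁ (Lfp-map P a)
    Lfp-map (P ∨ Q)     (inj₂ b) = inj₂ (Lfp-map Q b)
    Lfp-map (θ ⇒ Q)     f        = λ a → Lfp-map Q (f a)
    Lfp-map (∃′ P)      (z , a)  = z , Lfp-map P a
    Lfp-map (∀′ P)      f        = λ z → Lfp-map P (f z)

  from⁺ : ∀ {n} {A : Formula ar n} (P : Positive A) → ⟦ P ⟧⁺ Lfp ⊆ ⟦ A ⟧₂ Lfp
  from⁺ = Lfp-map (λ i x → fold (to⁺ (Φ⁺ i) x))

  leastFixedPoint : LeastFixedPoint (F Φ)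
  leastFixedPoint = record
    { μ     = Lfp
    ; fixed = λ i → (λ x → fold (to⁺ (Φ⁺ i) x)) , λ { (fold x) → from⁺ (Φ⁺ i) x }
    ; least = λ R fix i → Lfp-least (λ j → proj₁ (fix j))
    }

  lfp : Interpretation ar
  lfp = LeastFixedPoint.μ leastFixedPoint

------------------------------------------------------------------------
-- The tuple Φ_π

module _ (E : HornFormulaEquation) where

  open HornFormulaEquation E

  headArgs : ∀ j → Maybe (Atom ar n) → Maybe (Vec (Term n) (ar j))
  headArgs j nothing = nothing
  headArgs j (just (X , s̄)) with X ≟ᶠ j
  ... | yes refl = just s̄
  ... | no _     = nothing

  base : ∀ j → Clause ar n → Maybe (FO n × Vec (Term n) (ar j))
  base j (clause φ′ [] h) = Maybe.map (φ′ ,_) (headArgs j h)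
  base j (clause φ′ (_ ∷ _) h) = nothing

  ind : ∀ j → Clause ar n → Maybe (FO n × List (Atom ar n) × Vec (Term n) (ar j))
  ind j (clause φ′ [] h) = nothing
  ind j (clause φ′ b@(_ ∷ _) h) = Maybe.map (λ s̄ → φ′ , b , s̄) (headArgs j h)

  B : ∀ j → List (FO n × Vec (Term n) (ar j))
  B j = mapMaybe (base j) (clauses horn)

  Ind : ∀ j → List (FO n × List (Atom ar n) × Vec (Term n) (ar j))
  Ind j = mapMaybe (ind j) (clauses horn)

  -- Formulas for the j-th component have n + ar j variables: first the
  -- variables ȳ of the clauses, then z̄ⱼ.
  module _ (j : Fin m) where

    ȳ : Subst n (n + ar j)
    ȳ = tabulate (λ i → var (i ↑ˡ ar j))

    z̄ : Vec (Term (n + ar j)) (ar j)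
    z̄ = tabulate (λ i → var (n ↑ʳ i))

    z̄≈ : Vec (Term n) (ar j) → Formula ar (n + ar j)
    z̄≈ s̄ = ⋀ (Vec.toList (Vec.zipWith (λ z s → ⌊ z ≈ subᵗ ȳ s ⌋) z̄ s̄))

    baseDisjunct : FO n × Vec (Term n) (ar j) → Formula ar (n + ar j)
    baseDisjunct (φ′ , s̄) = ⌊ subᶠ ȳ φ′ ⌋ ∧ z̄≈ s̄

    bodyAtom : Atom ar n → Formula ar (n + ar j)
    bodyAtom (X , t̄) = atom X (Vec.map (subᵗ ȳ) t̄)

    indDisjunct : FO n × List (Atom ar n) × Vec (Term n) (ar j) → Formula ar (n + ar j)
    indDisjunct (φ′ , b , s̄) =
      ⌊ subᶠ ȳ φ′ ⌋ ∧ ⋀ (map bodyAtom b) ∧ z̄≈ s̄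

  Φ : Tuple ar
  Φ j = ∃* n (⋁ (map (baseDisjunct j) (B j)) ∨ ⋁ (map (indDisjunct j) (Ind j)))

module _ {m : ℕ} {ar : Fin m → ℕ} where

  ∃*-positive : ∀ k {n} {A : Formula ar (k + n)} → Positive A → Positive (∃* k A)
  ∃*-positive zero    P = P
  ∃*-positive (suc k) P = ∃*-positive k (∃′ P)

  ⋀-positive : ∀ {a} {I : Set a} {n} {f : I → Formula ar n} → (∀ i → Positive (f i)) →
               ∀ is → Positive (⋀ (map f is))
  ⋀-positive P []       = ⌊ true ⌋
  ⋀-positive P (i ∷ is) = P i ∧ ⋀-positive P is

  ⋁-positive : ∀ {a} {I : Set a} {n} {f : I → Formula ar n} → (∀ i → Positive (f i)) →
               ∀ is → Positive (⋁ (map f is))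
  ⋁-positive P []       = ⌊ false ⌋
  ⋁-positive P (i ∷ is) = P i ∨ ⋁-positive P is

  ≈-positive : ∀ {a n n′} {f : Term n′ → Term n} (zs : Vec (Term n) a) (ss : Vec (Term n′) a) →
               Positive (⋀ {ar = ar} (Vec.toList (Vec.zipWith (λ z s → ⌊ z ≈ f s ⌋) zs ss)))
  ≈-positive []       []       = ⌊ true ⌋
  ≈-positive (z ∷ zs) (s ∷ ss) = ⌊ _ ⌋ ∧ ≈-positive zs ss

Φ-positive : ∀ E j → Positive (Φ E j)
Φ-positive E j = ∃*-positive _
  (⋁-positive (λ { (φ′ , s̄) → ⌊ _ ⌋ ∧ ≈-positive (z̄ E j) s̄ }) (B E j) ∨
   ⋁-positive (λ { (φ′ , b , s̄) →
     ⌊ _ ⌋ ∧ ⋀-positive (λ (X , t̄) → atom X _) b ∧ ≈-positive (z̄ E j) s̄ }) (Ind E j))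

{-# OPTIONS --safe #-}

-- The pre-fixed points of F_Φ are exactly the interpretations satisfying the
-- clauses of π that have a head, and here every clause has one.  Hence lfp Φ
-- satisfies the verification condition, and soundness of Hoare logic gives
-- sp p φ ⊆ μ.  Conversely, the strongest postcondition together with suitable
-- intermediate assertions and loop invariants satisfies the verification
-- condition, so it is a pre-fixed point and contains μ.
module Submission where

open import Data.Empty using (⊥; ⊥-elim)
open import Data.Fin using (Fin; zero; suc; _↑ˡ_; _↑ʳ_; splitAt) renaming (_≟_ to _≟ᶠ_)
open import Data.Fin.Properties using (splitAt-↑ˡ; splitAt-↑ʳ)
open import Data.Integer as ℤ using (ℤ)
open import Data.List using (List; []; _∷_; mapMaybe; map)
open import Data.List.Relation.Unary.All as All using (All; []; _∷_)
open import Data.List.Relation.Unary.All.Properties as All using (++⁺; ++⁻)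
open import Data.Maybe using (Maybe; just; nothing; maybe′)
open import Data.Maybe.Relation.Unary.All as Maybe using (just; nothing)
open import Data.Nat using (ℕ; zero; suc; _+_)
open import Data.Product using (∃-syntax; _×_; _,_; proj₁; proj₂; map₂; uncurry)
open import Data.Product.Function.NonDependent.Propositional using (_×-⇔_)
open import Data.Sum using (inj₁; inj₂; [_,_]′)
open import Data.Sum.Function.Propositional using (_⊎-⇔_)
open import Data.Unit using (⊤; tt)
open import Data.Vec as Vec using (Vec; []; _∷_; lookup; tabulate; _[_]≔_) renaming (_++_ to _++ᵛ_)
open import Data.Vec.Properties
  using (map-∘; map-cong; map-[]≔; lookup-map; lookup-++ˡ; lookup-++ʳ; tabulate-∘; tabulate-cong;
         tabulate∘lookup; ∷-injective)
open import Function using (_∘_; _⇔_; mk⇔; Equivalence)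
open import Function.Construct.Composition using (_⇔-∘_)
open import Function.Construct.Identity using (⇔-id)
open import Function.Related.Propositional using (≡⇒)
open import Function.Related.TypeIsomorphisms using (→-cong-⇔)
open import Level using (0ℓ)
open import Relation.Binary.PropositionalEquality
  using (_≡_; refl; sym; trans; cong; cong₂; subst; module ≡-Reasoning)
open import Relation.Nullary using (yes; no)
open import Relation.Unary using (Pred; _⊆_; _≐_; _∩_)

open import Defs

open Equivalence using (to; from)

-- Substitution

eval-var : ∀ {n m} (ρ : Env n) (f : Fin m → Fin n) →
           Vec.map (eval ρ) (tabulate (var ∘ f)) ≡ tabulate (lookup ρ ∘ f)
eval-var ρ f = sym (tabulate-∘ (eval ρ) (var ∘ f))

eval-x̄ : ∀ {n} (ρ : Env n) → Vec.map (eval ρ) x̄ ≡ ρ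
eval-x̄ ρ = trans (eval-var ρ _) (tabulate∘lookup ρ)

eval-subᵗ : ∀ {n m} (σ : Subst n m) (t : Term n) (ρ : Env m) →
            eval ρ (subᵗ σ t) ≡ eval (Vec.map (eval ρ) σ) t
eval-subᵗ σ (var i) ρ = sym (lookup-map i (eval ρ) σ)
eval-subᵗ σ 𝟎       ρ = refl
eval-subᵗ σ 𝟏       ρ = refl
eval-subᵗ σ (s ⊕ t) ρ = cong₂ ℤ._+_ (eval-subᵗ σ s ρ) (eval-subᵗ σ t ρ)
eval-subᵗ σ (s ⊖ t) ρ = cong₂ ℤ._-_ (eval-subᵗ σ s ρ) (eval-subᵗ σ t ρ)
eval-subᵗ σ (s ⊗ t) ρ = cong₂ ℤ._*_ (eval-subᵗ σ s ρ) (eval-subᵗ σ t ρ)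

map-eval-subᵗ : ∀ {n m a} (σ : Subst n m) (ts : Vec (Term n) a) (ρ : Env m) →
                Vec.map (eval ρ) (Vec.map (subᵗ σ) ts) ≡ Vec.map (eval (Vec.map (eval ρ) σ)) ts
map-eval-subᵗ σ ts ρ =
  trans (sym (map-∘ (eval ρ) (subᵗ σ) ts)) (map-cong (λ t → eval-subᵗ σ t ρ) ts)

eval-lift : ∀ {n m} (σ : Subst n m) z (ρ : Env m) →
            Vec.map (eval (z ∷ ρ)) (lift σ) ≡ z ∷ Vec.map (eval ρ) σ
eval-lift σ z ρ = cong (z ∷_) (begin
  Vec.map (eval (z ∷ ρ)) (Vec.map (subᵗ (tabulate (var ∘ suc))) σ)
    ≡⟨ map-eval-subᵗ _ σ (z ∷ ρ) ⟩
  Vec.map (eval (Vec.map (eval (z ∷ ρ)) (tabulate (var ∘ suc)))) σ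
    ≡⟨ cong (λ ρ′ → Vec.map (eval ρ′) σ) (trans (eval-var (z ∷ ρ) suc) (tabulate∘lookup ρ)) ⟩
  Vec.map (eval ρ) σ ∎)
  where open ≡-Reasoning

∃-cong : {A B : Pred ℤ 0ℓ} → (∀ z → A z ⇔ B z) → (∃[ z ] A z) ⇔ (∃[ z ] B z)
∃-cong f = mk⇔ (map₂ (to (f _))) (map₂ (from (f _)))

∀-cong : {A B : Pred ℤ 0ℓ} → (∀ z → A z ⇔ B z) → (∀ z → A z) ⇔ (∀ z → B z)
∀-cong f = mk⇔ (λ g z → to (f z) (g z)) (λ g z → from (f z) (g z))

-- An equivalence rather than an equality of types: under a quantifier, equalities for each `z`
-- would combine into one only by function extensionality.
⟦subᶠ⟧ : ∀ {n m} (σ : Subst n m) (A : FO n) (ρ : Env m) →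
         ⟦ subᶠ σ A ⟧ ρ ⇔ ⟦ A ⟧ (Vec.map (eval ρ) σ)
⟦subᶠ⟧ σ (s ≈ t) ρ = ≡⇒ (cong₂ _≡_ (eval-subᵗ σ s ρ) (eval-subᵗ σ t ρ))
⟦subᶠ⟧ σ (s ≤ t) ρ = ≡⇒ (cong₂ ℤ._≤_ (eval-subᵗ σ s ρ) (eval-subᵗ σ t ρ))
⟦subᶠ⟧ σ true    ρ = ⇔-id ⊤
⟦subᶠ⟧ σ false   ρ = ⇔-id ⊥
⟦subᶠ⟧ σ (A ∧ B) ρ = ⟦subᶠ⟧ σ A ρ ×-⇔ ⟦subᶠ⟧ σ B ρ
⟦subᶠ⟧ σ (A ∨ B) ρ = ⟦subᶠ⟧ σ A ρ ⊎-⇔ ⟦subᶠ⟧ σ B ρ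
⟦subᶠ⟧ σ (A ⇒ B) ρ = →-cong-⇔ (⟦subᶠ⟧ σ A ρ) (⟦subᶠ⟧ σ B ρ)
⟦subᶠ⟧ σ (∃′ A)  ρ = ∃-cong λ z → ≡⇒ (cong ⟦ A ⟧ (eval-lift σ z ρ)) ⇔-∘ ⟦subᶠ⟧ (lift σ) A (z ∷ ρ)
⟦subᶠ⟧ σ (∀′ A)  ρ = ∀-cong λ z → ≡⇒ (cong ⟦ A ⟧ (eval-lift σ z ρ)) ⇔-∘ ⟦subᶠ⟧ (lift σ) A (z ∷ ρ)

module _ {m : ℕ} {ar : Fin m → ℕ} (R : Interpretation ar) where

  ⟦sub⟧ : ∀ {n n′} (σ : Subst n n′) (A : Formula ar n) (ρ : Env n′) →
          ⟦ sub σ A ⟧₂ R ρ ⇔ ⟦ A ⟧₂ R (Vec.map (eval ρ) σ)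
  ⟦sub⟧ σ ⌊ θ ⌋       ρ = ⟦subᶠ⟧ σ θ ρ
  ⟦sub⟧ σ (atom X ts) ρ = ≡⇒ (cong (R X) (map-eval-subᵗ σ ts ρ))
  ⟦sub⟧ σ (A ∧ B)     ρ = ⟦sub⟧ σ A ρ ×-⇔ ⟦sub⟧ σ B ρ
  ⟦sub⟧ σ (A ∨ B)     ρ = ⟦sub⟧ σ A ρ ⊎-⇔ ⟦sub⟧ σ B ρ
  ⟦sub⟧ σ (A ⇒ B)     ρ = →-cong-⇔ (⟦sub⟧ σ A ρ) (⟦sub⟧ σ B ρ)
  ⟦sub⟧ σ (∃′ A)      ρ = ∃-cong λ z → ≡⇒ (cong (⟦ A ⟧₂ R) (eval-lift σ z ρ)) ⇔-∘ ⟦sub⟧ (lift σ) A (z ∷ ρ)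
  ⟦sub⟧ σ (∀′ A)      ρ = ∀-cong λ z → ≡⇒ (cong (⟦ A ⟧₂ R) (eval-lift σ z ρ)) ⇔-∘ ⟦sub⟧ (lift σ) A (z ∷ ρ)

  ⟦[\\]⟧ : ∀ {n} (A : Formula ar n) j t (ρ : Env n) →
           ⟦ A [ j \\ t ] ⟧₂ R ρ ⇔ ⟦ A ⟧₂ R (ρ [ j ]≔ eval ρ t)
  ⟦[\\]⟧ A j t ρ =
    ≡⇒ (cong (⟦ A ⟧₂ R) (trans (map-[]≔ (eval ρ) x̄ j) (cong (_[ j ]≔ eval ρ t) (eval-x̄ ρ))))
      ⇔-∘ ⟦sub⟧ (x̄ [ j ]≔ t) A ρ

-- Pre-fixed points and clauses

module _ {m : ℕ} {ar : Fin m → ℕ} (R : Interpretation ar) where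

  ⟦∃*⟧ : ∀ k {n} {A : Formula ar (k + n)} {ρ : Env n} →
         ⟦ ∃* k A ⟧₂ R ρ ⇔ (∃[ ρ′ ] ⟦ A ⟧₂ R (ρ′ ++ᵛ ρ))
  ⟦∃*⟧ zero    = mk⇔ ([] ,_) λ { ([] , a) → a }
  ⟦∃*⟧ (suc k) = mk⇔ (λ { (ρ′ , z , a) → z ∷ ρ′ , a }) (λ { (z ∷ ρ′ , a) → ρ′ , z , a }) ⇔-∘ ⟦∃*⟧ k

  -- Phrased for maps out of the disjunction, because being a pre-fixed point is an implication with
  -- the disjunctions of `Φ` on its left; it splits into one implication per disjunct.
  ⟦⋁⟧-elim : ∀ {I : Set} {n} {f : I → Formula ar n} {P : Set} {ρ} is →
             (⟦ ⋁ (map f is) ⟧₂ R ρ → P) ⇔ All (λ i → ⟦ f i ⟧₂ R ρ → P) is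
  ⟦⋁⟧-elim []       = mk⇔ (λ _ → []) λ _ ()
  ⟦⋁⟧-elim (i ∷ is) = mk⇔
    (λ g → (g ∘ inj₁) ∷ to (⟦⋁⟧-elim is) (g ∘ inj₂))
    (λ { (h ∷ hs) → [ h , from (⟦⋁⟧-elim is) hs ]′ })

  ⟦⋀⟧ : ∀ {I : Set} {n} {f : I → Formula ar n} {ρ} is →
        ⟦ ⋀ (map f is) ⟧₂ R ρ ⇔ All (λ i → ⟦ f i ⟧₂ R ρ) is
  ⟦⋀⟧ []       = mk⇔ (λ _ → []) (λ _ → tt)
  ⟦⋀⟧ (i ∷ is) = mk⇔ (λ { (a , as) → a ∷ to (⟦⋀⟧ is) as }) (λ { (a ∷ as) → a , from (⟦⋀⟧ is) as })

  ⟦⋀≈⟧ : ∀ {a n n′} {f : Term n′ → Term n} {ρ} (zs : Vec (Term n) a) (ss : Vec (Term n′) a) →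
         ⟦ ⋀ {ar = ar} (Vec.toList (Vec.zipWith (λ z s → ⌊ z ≈ f s ⌋) zs ss)) ⟧₂ R ρ ⇔
         (Vec.map (eval ρ) zs ≡ Vec.map (eval ρ) (Vec.map f ss))
  ⟦⋀≈⟧ []       []       = mk⇔ (λ _ → refl) (λ _ → tt)
  ⟦⋀≈⟧ (z ∷ zs) (s ∷ ss) = mk⇔
    (λ { (e , es) → cong₂ _∷_ e (to (⟦⋀≈⟧ zs ss) es) })
    (map₂ (from (⟦⋀≈⟧ zs ss)) ∘ ∷-injective)

-- Carries facts about the extracted cases in `B` and `Ind` back to the clauses; a clause that
-- yields `nothing` has nothing to show.
mapMaybe⁻ : ∀ {A B : Set} {P : Pred B 0ℓ} (f : A → Maybe B) xs →
            All P (mapMaybe f xs) → All (Maybe.All P) (map f xs)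
mapMaybe⁻ f []       _  = []
mapMaybe⁻ f (x ∷ xs) ps with f x
... | nothing = nothing ∷ mapMaybe⁻ f xs ps
mapMaybe⁻ f (x ∷ xs) (p ∷ ps) | just _ = just p ∷ mapMaybe⁻ f xs ps

Holds : ∀ {m} {ar : Fin m → ℕ} {n} → Interpretation ar → Env n → Pred (Atom ar n) 0ℓ
Holds R ρ (X , ts) = R X (Vec.map (eval ρ) ts)

-- Clauses with head ⊥ count as satisfied, as they do not contribute to Φ.
Satisfies : ∀ {m} {ar : Fin m → ℕ} {n} → Interpretation ar → Env n → Pred (Clause ar n) 0ℓ
Satisfies R ρ (clause φ′ b h) = ⟦ φ′ ⟧ ρ → All (Holds R ρ) b → maybe′ (Holds R ρ) ⊤ h

module _ (E : HornFormulaEquation) (R : Interpretation (HornFormulaEquation.ar E)) where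

  open HornFormulaEquation E

  BaseHolds : Env n → ∀ j → Pred (FO n × Vec (Term n) (ar j)) 0ℓ
  BaseHolds ρ j (φ′ , s̄) = ⟦ φ′ ⟧ ρ → R j (Vec.map (eval ρ) s̄)

  IndHolds : Env n → ∀ j → Pred (FO n × List (Atom ar n) × Vec (Term n) (ar j)) 0ℓ
  IndHolds ρ j (φ′ , b , s̄) = ⟦ φ′ ⟧ ρ → All (Holds R ρ) b → R j (Vec.map (eval ρ) s̄)

  satisfies⇒base : ∀ {ρ} j c → Satisfies R ρ c → Maybe.All (BaseHolds ρ j) (base E j c)
  satisfies⇒base j (clause φ′ [] nothing) sat = nothing
  satisfies⇒base j (clause φ′ [] (just (X , s̄))) sat with X ≟ᶠ j
  ... | yes refl = just λ a → sat a []
  ... | no _     = nothing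
  satisfies⇒base j (clause φ′ (_ ∷ _) h) sat = nothing

  satisfies⇒ind : ∀ {ρ} j c → Satisfies R ρ c → Maybe.All (IndHolds ρ j) (ind E j c)
  satisfies⇒ind j (clause φ′ [] h) sat = nothing
  satisfies⇒ind j (clause φ′ (_ ∷ _) nothing) sat = nothing
  satisfies⇒ind j (clause φ′ (_ ∷ _) (just (X , s̄))) sat with X ≟ᶠ j
  ... | yes refl = just sat
  ... | no _     = nothing

  base,ind⇒satisfies : ∀ {ρ} c → (∀ j → Maybe.All (BaseHolds ρ j) (base E j c)) →
                       (∀ j → Maybe.All (IndHolds ρ j) (ind E j c)) → Satisfies R ρ c
  base,ind⇒satisfies (clause φ′ b nothing) hb hi _ _ = tt
  -- A clause contributes to the component of its own head, so `j` is taken to be `X`. The type of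
  -- `hb X` is stuck on the decision `X ≟ᶠ X`, so both are abstracted together.
  base,ind⇒satisfies (clause φ′ [] (just (X , s̄))) hb hi with X ≟ᶠ X | hb X
  ... | yes refl | just h = λ a _ → h a
  ... | no X≢X   | _      = ⊥-elim (X≢X refl)
  base,ind⇒satisfies (clause φ′ (_ ∷ _) (just (X , s̄))) hb hi with X ≟ᶠ X | hi X
  ... | yes refl | just h = h
  ... | no X≢X   | _      = ⊥-elim (X≢X refl)

  module _ (j : Fin m) (ρ : Env n) where

    eval-ȳ : ∀ ā → Vec.map (eval (ρ ++ᵛ ā)) (ȳ E j) ≡ ρ
    eval-ȳ ā = trans (eval-var (ρ ++ᵛ ā) (_↑ˡ ar j))
      (trans (tabulate-cong (lookup-++ˡ ρ ā)) (tabulate∘lookup ρ))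

    eval-z̄ : ∀ ā → Vec.map (eval (ρ ++ᵛ ā)) (z̄ E j) ≡ ā
    eval-z̄ ā = trans (eval-var (ρ ++ᵛ ā) (n ↑ʳ_))
      (trans (tabulate-cong (lookup-++ʳ ρ ā)) (tabulate∘lookup ā))

    eval-ȳ-terms : ∀ ā {a} (ts : Vec (Term n) a) →
      Vec.map (eval (ρ ++ᵛ ā)) (Vec.map (subᵗ (ȳ E j)) ts) ≡ Vec.map (eval ρ) ts
    eval-ȳ-terms ā ts =
      trans (map-eval-subᵗ (ȳ E j) ts _) (cong (λ ρ′ → Vec.map (eval ρ′) ts) (eval-ȳ ā))

    ⟦constraint⟧ : ∀ ā (φ′ : FO n) → ⟦ subᶠ (ȳ E j) φ′ ⟧ (ρ ++ᵛ ā) ⇔ ⟦ φ′ ⟧ ρ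
    ⟦constraint⟧ ā φ′ = ≡⇒ (cong ⟦ φ′ ⟧ (eval-ȳ ā)) ⇔-∘ ⟦subᶠ⟧ (ȳ E j) φ′ _

    ⟦z̄≈⟧ : ∀ ā s̄ → ⟦ z̄≈ E j s̄ ⟧₂ R (ρ ++ᵛ ā) ⇔ (ā ≡ Vec.map (eval ρ) s̄)
    ⟦z̄≈⟧ ā s̄ = ≡⇒ (cong₂ _≡_ (eval-z̄ ā) (eval-ȳ-terms ā s̄)) ⇔-∘ ⟦⋀≈⟧ R (z̄ E j) s̄

    ⟦body⟧ : ∀ ā b → ⟦ ⋀ (map (bodyAtom E j) b) ⟧₂ R (ρ ++ᵛ ā) ⇔ All (Holds R ρ) b
    ⟦body⟧ ā b = mk⇔
      (All.map (λ {(X , ts)} → subst (R X) (eval-ȳ-terms ā ts)))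
      (All.map (λ {(X , ts)} → subst (R X) (sym (eval-ȳ-terms ā ts))))
      ⇔-∘ ⟦⋀⟧ R b

    -- One-point rule: the equations `z̄≈ s̄` leave the value of `s̄` at `ρ` as the only choice for
    -- `ā`.
    base-disjunct : ∀ r → (∀ ā → ⟦ baseDisjunct E j r ⟧₂ R (ρ ++ᵛ ā) → R j ā) ⇔ BaseHolds ρ j r
    base-disjunct (φ′ , s̄) = mk⇔
      (λ h c → h _ (from (⟦constraint⟧ _ φ′) c , from (⟦z̄≈⟧ _ s̄) refl))
      (λ h ā (c , e) → subst (R j) (sym (to (⟦z̄≈⟧ ā s̄) e)) (h (to (⟦constraint⟧ ā φ′) c)))

    ind-disjunct : ∀ r → (∀ ā → ⟦ indDisjunct E j r ⟧₂ R (ρ ++ᵛ ā) → R j ā) ⇔ IndHolds ρ j r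
    ind-disjunct (φ′ , b , s̄) = mk⇔
      (λ h c as → h _ (from (⟦constraint⟧ _ φ′) c , from (⟦body⟧ _ b) as , from (⟦z̄≈⟧ _ s̄) refl))
      (λ h ā (c , as , e) → subst (R j) (sym (to (⟦z̄≈⟧ ā s̄) e))
        (h (to (⟦constraint⟧ ā φ′) c) (to (⟦body⟧ ā b) as)))

  -- The clause variables are existential in `Φ`, left of the inclusion, and so act universally: an
  -- element of `F (Φ E) R j` supplies a valuation `ρ` and a disjunct, and the clause behind that
  -- disjunct applies at `ρ`.
  satisfies⇒prefixed : (∀ ρ → All (Satisfies R ρ) (clauses horn)) → ∀ j → F (Φ E) R j ⊆ R j
  satisfies⇒prefixed sat j {ā} x with to (⟦∃*⟧ R n) x
  ... | ρ , y = [ from (⟦⋁⟧-elim R (B E j)) (All.map (λ h → from (base-disjunct j ρ _) h ā) bases)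
                , from (⟦⋁⟧-elim R (Ind E j)) (All.map (λ h → from (ind-disjunct j ρ _) h ā) inds) ]′ y
    where
    bases : All (BaseHolds ρ j) (B E j)
    bases = All.mapMaybe⁺ (All.map⁺ (All.map (λ {c} → satisfies⇒base j c) (sat ρ)))
    inds : All (IndHolds ρ j) (Ind E j)
    inds = All.mapMaybe⁺ (All.map⁺ (All.map (λ {c} → satisfies⇒ind j c) (sat ρ)))

  prefixed⇒satisfies : (∀ j → F (Φ E) R j ⊆ R j) → ∀ ρ → All (Satisfies R ρ) (clauses horn)
  prefixed⇒satisfies pre ρ = All.tabulate λ {c} c∈ → base,ind⇒satisfies c
    (λ j → All.lookup (All.map⁻ (mapMaybe⁻ (base E j) _ (bases j))) c∈)
    (λ j → All.lookup (All.map⁻ (mapMaybe⁻ (ind E j) _ (inds j))) c∈)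
    where
    bases : ∀ j → All (BaseHolds ρ j) (B E j)
    bases j = All.tabulate λ {r} r∈ → to (base-disjunct j ρ r) λ ā →
      -- Each disjunct alone implies the whole component: `ρ` witnesses the quantifiers and `inj₁`
      -- selects the base cases.
      All.lookup (to (⟦⋁⟧-elim R (B E j)) λ x → pre j (from (⟦∃*⟧ R n) (ρ , inj₁ x))) r∈
    inds : ∀ j → All (IndHolds ρ j) (Ind E j)
    inds j = All.tabulate λ {r} r∈ → to (ind-disjunct j ρ r) λ ā →
      All.lookup (to (⟦⋁⟧-elim R (Ind E j)) λ x → pre j (from (⟦∃*⟧ R n) (ρ , inj₂ x))) r∈

-- Horn formulas and clauses

module _ {m : ℕ} {ar : Fin m → ℕ} {n : ℕ} where

  -- A conjunct with first-order conclusion becomes a clause without head, on which pre-fixed points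
  -- give no information. Excluding such conjuncts makes the passage from clauses back to the
  -- formula possible.
  Definite : ∀ {A : Formula ar n} → Horn A → Set
  Definite (A ⇒ ⌊ θ ⌋)     = ⊥
  Definite (A ⇒ atom X ts) = ⊤
  Definite (A ∧ B)         = Definite A × Definite B

  module _ (R : Interpretation ar) {ρ : Env n} where

    ⟦premise⟧ : ∀ {A} (P : Premise A) →
                ⟦ A ⟧₂ R ρ ⇔ (⟦ constraint P ⟧ ρ × All (Holds R ρ) (atoms P))
    ⟦premise⟧ ⌊ θ ⌋       = mk⇔ (_, []) proj₁
    ⟦premise⟧ (atom X ts) = mk⇔ (λ a → tt , a ∷ []) λ { (_ , a ∷ []) → a }
    ⟦premise⟧ (P ∧ Q)     = mk⇔
      (λ (a , b) → let c , as = to (⟦premise⟧ P) a; d , bs = to (⟦premise⟧ Q) b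
                   in (c , d) , ++⁺ as bs)
      (λ ((c , d) , cs) → let as , bs = ++⁻ (atoms P) cs
                          in from (⟦premise⟧ P) (c , as) , from (⟦premise⟧ Q) (d , bs))

    horn⇒clauses : ∀ {A} (H : Horn A) → ⟦ A ⟧₂ R ρ → All (Satisfies R ρ) (clauses H)
    horn⇒clauses (P ⇒ ⌊ θ ⌋)     h       = (λ _ _ → tt) ∷ []
    horn⇒clauses (P ⇒ atom X ts) h       = (λ c as → h (from (⟦premise⟧ P) (c , as))) ∷ []
    horn⇒clauses (G ∧ H)         (g , h) = ++⁺ (horn⇒clauses G g) (horn⇒clauses H h)

    clauses⇒horn : ∀ {A} (H : Horn A) → Definite H → All (Satisfies R ρ) (clauses H) → ⟦ A ⟧₂ R ρ
    clauses⇒horn (P ⇒ atom X ts) _       (s ∷ []) = uncurry s ∘ to (⟦premise⟧ P)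
    clauses⇒horn (G ∧ H)         (d , e) ss       =
      let gs , hs = ++⁻ (clauses G) ss in clauses⇒horn G d gs , clauses⇒horn H e hs

-- Every conclusion is either a fresh predicate variable or the postcondition, possibly after a
-- substitution, which keeps atoms atomic. This is where it matters that the postcondition is a
-- predicate variable.
vc̃-horn-definite : ∀ {k m} (p : Program k) (ν : Fin (fresh p) → Fin m) {φ : Formula (λ _ → k) k}
                   (P : Premise φ) X ts → Definite (vc̃-horn p ν P (atom X ts))
vc̃-horn-definite skip                   ν P X ts = tt
vc̃-horn-definite (j ≔ t)                ν P X ts = tt
vc̃-horn-definite (p ⨾ q)                ν P X ts =
  vc̃-horn-definite p _ P _ _ , vc̃-horn-definite q _ (atom _ _) X ts
vc̃-horn-definite (if T then p else q)   ν P X ts =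
  vc̃-horn-definite p _ (P ∧ ⌊ _ ⌋) X ts , vc̃-horn-definite q _ (P ∧ ⌊ _ ⌋) X ts
vc̃-horn-definite (while T do′ p)        ν P X ts =
  vc̃-horn-definite p _ (atom _ _ ∧ ⌊ _ ⌋) _ _ , tt , tt

-- Soundness and completeness of verification conditions

module _ {k m : ℕ} (R : Interpretation {m} (λ _ → k)) where

  -- Induction on the program, with `R` supplying midpoint assertions and invariants. The condition
  -- is assumed at all `ρ` because a run applies it at every state it passes through.
  vc̃-sound : ∀ p ν {φ ψ} → (∀ ρ → ⟦ vc̃ p ν φ ψ ⟧₂ R ρ) →
             ∀ {σ σ′} → ⟦ φ ⟧₂ R σ → C p σ σ′ → ⟦ ψ ⟧₂ R σ′
  vc̃-sound skip ν v a refl = v _ a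
  vc̃-sound (j ≔ t) ν {ψ = ψ} v {σ} a refl = to (⟦[\\]⟧ R ψ j t σ) (v σ a)
  vc̃-sound (p ⨾ q) ν v a (τ , c , d) =
    vc̃-sound q _ (proj₂ ∘ v) (vc̃-sound p _ (proj₁ ∘ v) a c) d
  vc̃-sound (if T then p else q) ν v a (inj₁ (b , c)) = vc̃-sound p _ (proj₁ ∘ v) (a , b) c
  vc̃-sound (if T then p else q) ν v a (inj₂ (b , c)) = vc̃-sound q _ (proj₂ ∘ v) (a , b) c
  vc̃-sound (while T do′ p) ν {ψ = ψ} v {σ} a w = run (proj₁ (proj₂ (v σ)) a) w
    where
    -- Inner induction on the run of the loop, started from any state satisfying the invariant.
    run : ∀ {σ σ′} → ⟦ atom (ν zero) x̄ ⟧₂ R σ → While ⟦ formula T ⟧ (C p) σ σ′ → ⟦ ψ ⟧₂ R σ′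
    run i (exit ¬b)    = proj₂ (proj₂ (v _)) (i , ¬b)
    run i (loop b c w) = run (vc̃-sound p _ (proj₁ ∘ v) (i , b) c) w

-- The analogue of `sp` for semantic preconditions, as the intermediate assertions are predicates
-- and not formulas.
post : ∀ {k} → Program k → Pred (State k) 0ℓ → Pred (State k) 0ℓ
post p P σ = ∃[ σ′ ] P σ′ × C p σ′ σ

-- Stated through termination rather than reachability by iterations: since
-- While grows at its front, this is preserved by the body without an induction.
loopInvariant : ∀ {k} → Test k → Program k → Pred (State k) 0ℓ → Pred (State k) 0ℓ
loopInvariant T p P σ =
  ∃[ σ₀ ] P σ₀ × (∀ {τ} → C (while T do′ p) σ τ → C (while T do′ p) σ₀ τ)

-- Propagates the precondition `P` forward through the program. `splitAt` undoes the numbering by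
-- which `vc̃` shares out the fresh variables between two subprograms.
assertions : ∀ {k} (p : Program k) → Pred (State k) 0ℓ → Fin (fresh p) → Pred (State k) 0ℓ
assertions (p ⨾ q) P zero    = post p P
assertions (p ⨾ q) P (suc i) = [ assertions p P , assertions q (post p P) ]′ (splitAt (fresh p) i)
assertions (if T then p else q) P i =
  [ assertions p (P ∩ ⟦ formula T ⟧) , assertions q (P ∩ ⟦ ¬ formula T ⟧) ]′ (splitAt (fresh p) i)
assertions (while T do′ p) P zero    = loopInvariant T p P
assertions (while T do′ p) P (suc i) = assertions p (loopInvariant T p P ∩ ⟦ formula T ⟧) i

module _ {k m : ℕ} (R : Interpretation {m} (λ _ → k)) where

  ⟦atom-x̄⟧ : ∀ {X P} → R X ≡ P → ∀ {ρ} → ⟦ atom X x̄ ⟧₂ R ρ ⇔ P ρ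
  ⟦atom-x̄⟧ {X} refl {ρ} = ≡⇒ (cong (R X) (eval-x̄ ρ))

  -- The formulas `φ` and `ψ` may contain predicate variables, so the induction carries a semantic
  -- `P` above `φ`, and of `ψ` it knows only that every terminating run from `P` ends in it.
  vc̃-complete : ∀ p ν P {φ ψ} → (∀ i → R (ν i) ≡ assertions p P i) →
                ⟦ φ ⟧₂ R ⊆ P → (∀ {σ σ′} → P σ → C p σ σ′ → ⟦ ψ ⟧₂ R σ′) →
                ∀ ρ → ⟦ vc̃ p ν φ ψ ⟧₂ R ρ
  vc̃-complete skip ν P R≡ pre pst ρ a = pst (pre a) refl
  vc̃-complete (j ≔ t) ν P {ψ = ψ} R≡ pre pst ρ a = from (⟦[\\]⟧ R ψ j t ρ) (pst (pre a) refl)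
  vc̃-complete (p ⨾ q) ν P R≡ pre pst ρ =
    vc̃-complete p _ P (λ i → trans (R≡ (suc (i ↑ˡ fresh q))) (cong [ _ , _ ]′ (splitAt-↑ˡ (fresh p) i (fresh q))))
      pre (λ a c → from (⟦atom-x̄⟧ (R≡ zero)) (_ , a , c)) ρ ,
    vc̃-complete q _ (post p P)
      (λ i → trans (R≡ (suc (fresh p ↑ʳ i))) (cong [ _ , _ ]′ (splitAt-↑ʳ (fresh p) (fresh q) i)))
      (to (⟦atom-x̄⟧ (R≡ zero))) (λ (_ , a , c) d → pst a (_ , c , d)) ρ
  vc̃-complete (if T then p else q) ν P R≡ pre pst ρ =
    vc̃-complete p _ (P ∩ ⟦ formula T ⟧)
      (λ i → trans (R≡ (i ↑ˡ fresh q)) (cong [ _ , _ ]′ (splitAt-↑ˡ (fresh p) i (fresh q))))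
      (λ (a , b) → pre a , b) (λ (a , b) c → pst a (inj₁ (b , c))) ρ ,
    vc̃-complete q _ (P ∩ ⟦ ¬ formula T ⟧)
      (λ i → trans (R≡ (fresh p ↑ʳ i)) (cong [ _ , _ ]′ (splitAt-↑ʳ (fresh p) (fresh q) i)))
      (λ (a , b) → pre a , b) (λ (a , b) c → pst a (inj₂ (b , c))) ρ
  vc̃-complete (while T do′ p) ν P R≡ pre pst ρ =
    vc̃-complete p _ (loopInvariant T p P ∩ ⟦ formula T ⟧) (R≡ ∘ suc)
      (λ (i , b) → to I i , b)
      -- A loop run from the state after the body, preceded by this iteration, is a loop run from
      -- the state before it, and `r` moves that to the initial state.
      (λ ((_ , a , r) , b) c → from I (_ , a , r ∘ loop b c)) ρ ,
    (λ a → from I (ρ , pre a , λ w → w)) ,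
    -- On exit the run with no iterations ends here, so `r` makes it a complete run from the initial
    -- state, as `pst` requires.
    (λ (i , ¬b) → let _ , a , r = to I i in pst a (r (exit ¬b)))
    where
    I : ∀ {σ} → ⟦ atom (ν zero) x̄ ⟧₂ R σ ⇔ loopInvariant T p P σ
    I = ⟦atom-x̄⟧ (R≡ zero)

-- The least fixed point and the strongest postcondition

strongest : ∀ {k} (p : Program k) → FO k → Interpretation {suc (fresh p)} (λ _ → k)
strongest p φ zero    = sp p φ
strongest p φ (suc i) = assertions p ⟦ φ ⟧ i

corollary18 : ∀ {k : ℕ} (p : Program k) (φ : FO k) →
              let E = ∃X₀vc p φ
                  μ = lfp (Φ E) (Φ-positive E) zero
              in [ μ ] ≐ sp p φ
corollary18 {k} p φ = [μ]⊆sp , sp⊆[μ]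
  where
  E = ∃X₀vc p φ
  open HornFormulaEquation E using (matrix; horn)

  Lfp-Φ : Interpretation {suc (fresh p)} (λ _ → k)
  Lfp-Φ = lfp (Φ E) (Φ-positive E)

  strongest-satisfies : ∀ ρ → ⟦ matrix ⟧₂ (strongest p φ) ρ
  strongest-satisfies = vc̃-complete (strongest p φ) p suc ⟦ φ ⟧ (λ _ → refl) (λ a → a)
    (λ a c → from (⟦atom-x̄⟧ (strongest p φ) {zero} refl) (_ , a , c))

  strongest-prefixed : ∀ j → F (Φ E) (strongest p φ) j ⊆ strongest p φ j
  strongest-prefixed = satisfies⇒prefixed E (strongest p φ)
    (λ ρ → horn⇒clauses (strongest p φ) horn (strongest-satisfies ρ))

  [μ]⊆sp : [ Lfp-Φ zero ] ⊆ sp p φ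
  [μ]⊆sp {σ} x =
    subst (sp p φ) (eval-x̄ σ) (Lfp-least (Φ E) (Φ-positive E) {strongest p φ} strongest-prefixed x)

  Lfp-satisfies : ∀ ρ → ⟦ matrix ⟧₂ Lfp-Φ ρ
  Lfp-satisfies ρ = clauses⇒horn Lfp-Φ horn (vc̃-horn-definite p suc ⌊ φ ⌋ zero x̄)
    (prefixed⇒satisfies E Lfp-Φ
      (λ j → proj₁ (LeastFixedPoint.fixed (leastFixedPoint (Φ E) (Φ-positive E)) j)) ρ)

  sp⊆[μ] : sp p φ ⊆ [ Lfp-Φ zero ]
  -- The postcondition `atom zero x̄` unfolds to membership in `[ Lfp-Φ zero ]`, so no transport
  -- along `eval-x̄` occurs here.
  sp⊆[μ] (_ , a , c) = vc̃-sound Lfp-Φ p suc Lfp-satisfies a c
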